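{- Let $s\ge 1$ and $n\ge 4s$ be integers, and let $T^{n,n-s}$ be the labeled $(n-s)$-grid obtained from the all-ones $n$-grid by $s$ reductions. For each integer $d$ with $1\le d\le s$ consider the three sets of triangles $$U_1(d)=\{T^{n,n-s}_{r,d} : s+d\le r\le n-2s\},$$ $$U_2(d)=\{T^{n,n-s}_{r,r+1-d} : s+d\le r\le n-2s\},$$ $$U_3(d)=\{T^{n,n-s}_{n-s-d+1,\,p} : s+d\le p\le n-2s\},$$ whose union is called the uniform center. Then: (a) For each $d$ with $1\le d\le s$ and each $i\in\{1,2,3\}$, all triangles in $U_i(d)$ have a single pre-type. (b) For each $d$ with $1\le d\le s$, all triangles in $U_1(d)\cup U_2(d)\cup U_3(d)$ are of the same type. (c) In the $s$-subgrid $T^{n,n-s,s}$ all interior edge labels are equal to $1$, and all edge labels on the edge boundary $\partial^2T^{n,n-s,s}$ are equal to each other. (d) For every $d$ with $1\le d\le s$: every triangle in $U_1(d)$ has equal right and base labels; every triangle in $U_2(d)$ has equal left and base labels; every triangle in $U_3(d)$ has equal left and right labels.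
   Context: Labeled grids. An $N$-grid is the triangular grid graph with $N$ rows of upright triangles. The upright triangles are $T_{r,d}$ with $1\le d\le r\le N$ ($r$ is the row, counted from the top; $d$ is the diagonal, counted from the left). Each edge of the grid is a side of exactly one upright triangle, and the left, right and base sides of $T_{r,d}$ are denoted $T_{r,d,L},T_{r,d,R},T_{r,d,B}$. The bottom-right vertex of $T_{r,d}$, the bottom-left vertex of $T_{r,d+1}$ and the top vertex of $T_{r+1,d+1}$ coincide (whenever these exist). A labeled $N$-grid assigns a positive real number (resistance) to each edge; the symbol $T_{r,d,X}$, $X\in\{L,R,B\}$, also denotes this label. Reduction. For positive reals put $\Delta(x,y,z)=\frac{xy}{x+y+z}$ and $Y(x,y,z)=\frac{xy+yz+zx}{x}$. The reduction of a labeled $N$-grid ($N\ge2$) is a labeled $(N-1)$-grid obtained by applying $\Delta$–Y transformations to all upright triangles, discarding the three corner tails, making series transformations along the boundary and Y–$\Delta$ transformations in the interior. Explicitly, if $T_{r,d}$ has labels $(l,\rho,b)$ on its (left, right, base) sides, set $Y_{12,r,d}=\Delta(l,\rho,b)$, $Y_{8,r,d}=\Delta(b,l,\rho)$, $Y_{4,r,d}=\Delta(\rho,b,l)$. The reduced grid has, for $1\le d\le r\le N-1$, labels left: $Y_{8,r,1}+Y_{12,r+1,1}$ if $d=1$, and $Y(Y_{4,r,d-1},Y_{8,r,d},Y_{12,r+1,d})$ if $d\ge2$; right: $Y_{4,r,r}+Y_{12,r+1,r+1}$ if $d=r$, and $Y(Y_{8,r,d+1},Y_{12,r+1,d+1},Y_{4,r,d})$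 if $d\le r-1$; base: $Y_{4,N,d}+Y_{8,N,d+1}$ if $r=N-1$, and $Y(Y_{12,r+2,d+1},Y_{4,r+1,d},Y_{8,r+1,d+1})$ if $r\le N-2$. $T^{n}=T^{n,n}$ is the $n$-grid with all labels equal to $1$, and $T^{n,m}$ (for $1\le m\le n$) is the labeled $m$-grid obtained from it by $n-m$ successive reductions. $T^{n,m}_{r,d}$ is its triangle in row $r$ and diagonal $d$. Pre-type and type. The pre-type of $T_{r,d}$ is the ordered triple of labels (left, right, base). Two triangles have the same type if their pre-types agree up to a permutation of the three entries (i.e. up to a symmetry of the triangle). Subgrids. For $s\ge1$ the $s$-subgrid $T^{n,m,s}$ of $T^{n,m}$ is the triangular subgrid with corner triangles $T_{2s-1,s}$, $T_{m+1-s,s}$, $T_{m+1-s,m+2-2s}$, i.e. it consists of the triangles $T_{r,d}$ with $2s-1\le r\le m+1-s$, $s\le d\le r-s+1$. Its edge boundary $\partial^2T^{n,m,s}$ consists of the edges $T_{r,s,L}$ and $T_{r,r-s+1,R}$ for $2s-1\le r\le m+1-s$, and $T_{m+1-s,d,B}$ for $s\le d\le m+2-2s$. Its interior consists of all edges of triangles of $T^{n,m,s}$ not in $\partial^2T^{n,m,s}$.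
   Formalization: U_3(d) is taken as {T_{n-s-d+1, p+1-d} : s+d ≤ p ≤ n-2s} instead of with diagonal p; as printed the claim is false, e.g. for s = d = 2, n = 8 the triangle T_{5,4} has left label 1 and right label 26/27. -}

module Defs where

open import Data.Bool.Base using (if_then_else_)
open import Data.List.Base using (List; []; _∷_)
open import Data.List.Relation.Binary.Permutation.Propositional using (_↭_)
open import Data.Nat.Base using (ℕ; zero; suc; _∸_; _≤_; _≡ᵇ_)
  renaming (_+_ to _+ℕ_; _*_ to _*ℕ_)
open import Data.Product using (_×_; _,_; ∃-syntax)
open import Data.Rational.Base using (ℚ; Positive; 1ℚ; 1/_)
  renaming (_+_ to _+ℚ_; _*_ to _*ℚ_)
open import Data.Rational.Properties
  using (pos+pos⇒pos; pos*pos⇒pos; pos⇒nonZero; 1/pos⇒pos)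
open import Data.Sum.Base using (_⊎_)
open import Level using (0ℓ)
open import Relation.Binary.PropositionalEquality using (_≡_)
open import Relation.Nullary using (¬_)
open import Relation.Unary using (Pred; _∈_; _∪_)

infixl 6 _+_
infixl 7 _*_ _/_

-- Resistances are positive rationals: reductions use only +, * and division,
-- so no grid obtained from the all-ones grid has an irrational label.
-- Positivity is irrelevant, so _≡_ on ℚ⁺ is equality of the underlying values.
record ℚ⁺ : Set where
  constructor mkℚ⁺
  field
    value     : ℚ
    .positive : Positive value

open ℚ⁺ public

1⁺ : ℚ⁺
1⁺ = mkℚ⁺ 1ℚ _

_+_ _*_ _/_ : ℚ⁺ → ℚ⁺ → ℚ⁺
mkℚ⁺ x x>0 + mkℚ⁺ y y>0 =
  mkℚ⁺ (x +ℚ y) (pos+pos⇒pos x {{x>0}} y {{y>0}})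
mkℚ⁺ x x>0 * mkℚ⁺ y y>0 =
  mkℚ⁺ (x *ℚ y) (pos*pos⇒pos x {{x>0}} y {{y>0}})
mkℚ⁺ x x>0 / mkℚ⁺ y y>0 =
  mkℚ⁺ (x *ℚ (1/ y) {{pos⇒nonZero y {{y>0}}}})
       (pos*pos⇒pos x {{x>0}} ((1/ y) {{pos⇒nonZero y {{y>0}}}}) {{1/pos⇒pos y {{y>0}}}})

Δ Y : ℚ⁺ → ℚ⁺ → ℚ⁺ → ℚ⁺
Δ x y z = (x * y) / (x + y + z)
Y x y z = (x * y + y * z + z * x) / x

data Side : Set where
  L R B : Side

record PreType : Set where
  constructor ⟨_,_,_⟩
  field
    left right base : ℚ⁺

open PreType public

side : Side → PreType → ℚ⁺
side L = left
side R = right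
side B = base

SameType : PreType → PreType → Set
SameType τ τ′ = entries τ ↭ entries τ′
  where
  entries : PreType → List ℚ⁺
  entries ⟨ l , ρ , b ⟩ = l ∷ ρ ∷ b ∷ []

-- (r , d) is the upright triangle in row r and diagonal d, both counted from 1.
Triangle : Set
Triangle = ℕ × ℕ

Edge : Set
Edge = Triangle × Side

-- Only the values at (r , d) with 1 ≤ d ≤ r ≤ N are labels of the N-grid; the
-- others carry no meaning.  The labels with 1 ≤ d ≤ r ≤ N of a reduction depend
-- only on meaningful labels of the grid being reduced.
record LabeledGrid (N : ℕ) : Set where
  constructor grid
  field
    preType : Triangle → PreType

open LabeledGrid public

label : ∀ {N} → LabeledGrid N → Edge → ℚ⁺
label g (t , X) = side X (preType g t)

allOnes : ∀ N → LabeledGrid N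
allOnes N = grid (λ _ → ⟨ 1⁺ , 1⁺ , 1⁺ ⟩)

module Reduction {M : ℕ} (g : LabeledGrid (suc M)) where

  Y₁₂ Y₈ Y₄ : ℕ → ℕ → ℚ⁺
  Y₁₂ r d = let ⟨ l , ρ , b ⟩ = preType g (r , d) in Δ l ρ b
  Y₈  r d = let ⟨ l , ρ , b ⟩ = preType g (r , d) in Δ b l ρ
  Y₄  r d = let ⟨ l , ρ , b ⟩ = preType g (r , d) in Δ ρ b l

  newLeft newRight newBase : ℕ → ℕ → ℚ⁺
  newLeft r d =
    if d ≡ᵇ 1
    then Y₈ r 1 + Y₁₂ (suc r) 1
    else Y (Y₄ r (d ∸ 1)) (Y₈ r d) (Y₁₂ (suc r) d)
  newRight r d =
    if d ≡ᵇ r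
    then Y₄ r r + Y₁₂ (suc r) (suc r)
    else Y (Y₈ r (suc d)) (Y₁₂ (suc r) (suc d)) (Y₄ r d)
  newBase r d =
    if r ≡ᵇ M
    then Y₄ (suc M) d + Y₈ (suc M) (suc d)
    else Y (Y₁₂ (suc (suc r)) (suc d)) (Y₄ (suc r) d) (Y₈ (suc r) (suc d))

reduce : ∀ {M} → LabeledGrid (suc M) → LabeledGrid M
reduce g = grid (λ (r , d) → ⟨ newLeft r d , newRight r d , newBase r d ⟩)
  where open Reduction g

reductions : ∀ (k m : ℕ) → LabeledGrid m
reductions zero    m = allOnes m
reductions (suc k) m = reduce (reductions k (suc m))

-- reductions k m starts from the all-ones (k + m)-grid, so for m ≤ n this is
-- the m-grid obtained from the all-ones n-grid by n - m reductions.
T : ∀ (n m : ℕ) → LabeledGrid m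
T n m = reductions (n ∸ m) m

module UniformCenter (n s d : ℕ) where

  InRange : Pred ℕ 0ℓ
  InRange q = s +ℕ d ≤ q × q ≤ n ∸ 2 *ℕ s

  -- U₂ and U₃ are the images of U₁ under the symmetries of the (n - s)-grid.
  -- The diagonal q + 1 - d in U₃ thus runs from s + 1 to n - 2s - d + 1.  It
  -- cannot be replaced by q: for s = d = 2, n = 8, row 5 would then include
  -- the corner triangle (5 , 4) of the 2-subgrid, of another type.
  U₁ U₂ U₃ : Pred Triangle 0ℓ
  U₁ t = ∃[ q ] q ∈ InRange × t ≡ (q , d)
  U₂ t = ∃[ q ] q ∈ InRange × t ≡ (q , suc q ∸ d)
  U₃ t = ∃[ q ] q ∈ InRange × t ≡ (suc (n ∸ s ∸ d) , suc q ∸ d)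

  U : Pred Triangle 0ℓ
  U = U₁ ∪ U₂ ∪ U₃

SinglePreType : ∀ {N} → LabeledGrid N → Pred Triangle 0ℓ → Set
SinglePreType g P = ∃[ τ ] (∀ t → t ∈ P → preType g t ≡ τ)

-- The s-subgrid of an m-grid.
module Subgrid (m s : ℕ) where

  Row : Pred ℕ 0ℓ
  Row r = 2 *ℕ s ∸ 1 ≤ r × r ≤ suc m ∸ s

  Triangles : Pred Triangle 0ℓ
  Triangles (r , d) = r ∈ Row × s ≤ d × d ≤ suc (r ∸ s)

  ∂² : Pred Edge 0ℓ
  ∂² e =
      (∃[ r ] r ∈ Row × e ≡ ((r , s) , L))
    ⊎ (∃[ r ] r ∈ Row × e ≡ ((r , suc (r ∸ s)) , R))
    ⊎ (∃[ d ] (s ≤ d × d ≤ suc (suc m) ∸ 2 *ℕ s) × e ≡ ((suc m ∸ s , d) , B))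

  Interior : Pred Edge 0ℓ
  Interior (t , X) = t ∈ Triangles × ¬ ((t , X) ∈ ∂²)

{-# OPTIONS --safe #-}

-- Describe a triangle by the numbers (i , j , l) of triangles that separate it from the
-- left, right and base sides of the grid: d = i + 1, r = i + j + 1, N = i + j + l + 1.
-- In these coordinates reduction no longer mentions N and commutes with the rotation
-- of the grid, so only the neighbourhood of the left side has to be studied.  There, by
-- induction on k, the pre-type after k reductions depends only on i as long as j, l ≥ k,
-- and it is (1, 1, 1) for i ≥ k; the left label alone already depends only on i when
-- j, l ≥ k - 1, which accounts for the corners of the subgrid.
module Submission where

open import Defs using (SinglePreType; SameType; T; preType; label; left; right; base; 1⁺; module UniformCenter; module Subgrid)
open import Data.Nat.Base using (ℕ; _≤_; _∸_; _*_)
open import Data.Product using (_×_)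
open import Relation.Binary.PropositionalEquality using (_≡_)
open import Relation.Unary using (_∈_)

open import Data.Bool.Base using (true; false; if_then_else_)
open import Data.List.Base using (_∷_; [])
open import Data.List.Relation.Binary.Permutation.Propositional using (↭-refl; ↭-sym; ↭-trans)
open import Data.List.Relation.Binary.Permutation.Propositional.Properties using (shift)
open import Data.Nat.Base using (zero; suc; _+_; _≡ᵇ_; z≤n; s≤s; s≤s⁻¹)
open import Data.Nat.Properties
  using (≤-refl; ≤-reflexive; ≤-trans; n≤1+n; m≤n⇒m≤1+n; m≤m+n; m≤n+m; m≤n+m∸n; +-assoc; +-comm; +-suc;
         +-identityʳ; +-cancelˡ-≡; +-monoˡ-≤; suc-injective; m≤n⇒∃[o]m+o≡n; m∸n+n≡m; m+n∸m≡n; m+[n∸m]≡n;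
         m∸[m∸n]≡n; ∸-+-assoc; m+n≤o⇒m≤o∸n; m≤o∸n⇒m+n≤o)
open import Data.Nat.Tactic.RingSolver using (solve-∀)
open import Data.Product using (∃-syntax; _,_)
import Data.Rational.Base as ℚ
import Data.Rational.Properties as ℚ
open import Data.Sum.Base using (inj₁; inj₂)
open import Defs using (ℚ⁺; PreType; L; R; B; Triangle; ⟨_,_,_⟩; Δ; Y; reductions)
  renaming (_+_ to _+⁺_; _*_ to _*⁺_; _/_ to _/⁺_)
open import Relation.Binary.PropositionalEquality
  using (refl; sym; trans; cong; cong₂; subst; module ≡-Reasoning)
open import Relation.Nullary using (¬_; contradiction)

-- Positive rationals and the symmetries of `Δ` and `Y`.

ℚ⁺-≡ : ∀ {x y} → ℚ⁺.value x ≡ ℚ⁺.value y → x ≡ y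
ℚ⁺-≡ refl = refl

+⁺-comm : ∀ x y → x +⁺ y ≡ y +⁺ x
+⁺-comm x y = ℚ⁺-≡ (ℚ.+-comm (ℚ⁺.value x) (ℚ⁺.value y))

+⁺-assoc : ∀ x y z → (x +⁺ y) +⁺ z ≡ x +⁺ (y +⁺ z)
+⁺-assoc x y z = ℚ⁺-≡ (ℚ.+-assoc (ℚ⁺.value x) (ℚ⁺.value y) (ℚ⁺.value z))

*⁺-comm : ∀ x y → x *⁺ y ≡ y *⁺ x
*⁺-comm x y = ℚ⁺-≡ (ℚ.*-comm (ℚ⁺.value x) (ℚ⁺.value y))

Δ-comm : ∀ x y z → Δ x y z ≡ Δ y x z
Δ-comm x y z = cong₂ _/⁺_ (*⁺-comm x y) (cong (_+⁺ z) (+⁺-comm x y))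

Y-comm : ∀ x y z → Y x y z ≡ Y x z y
Y-comm x y z = cong (_/⁺ x) (begin
  (x *⁺ y +⁺ y *⁺ z) +⁺ z *⁺ x  ≡⟨ cong₂ _+⁺_ (cong₂ _+⁺_ (*⁺-comm x y) (*⁺-comm y z)) (*⁺-comm z x) ⟩
  (y *⁺ x +⁺ z *⁺ y) +⁺ x *⁺ z  ≡⟨ +⁺-comm (y *⁺ x +⁺ z *⁺ y) (x *⁺ z) ⟩
  x *⁺ z +⁺ (y *⁺ x +⁺ z *⁺ y)  ≡⟨ cong (x *⁺ z +⁺_) (+⁺-comm (y *⁺ x) (z *⁺ y)) ⟩
  x *⁺ z +⁺ (z *⁺ y +⁺ y *⁺ x)  ≡⟨ +⁺-assoc (x *⁺ z) (z *⁺ y) (y *⁺ x) ⟨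
  (x *⁺ z +⁺ z *⁺ y) +⁺ y *⁺ x  ∎)
  where open ≡-Reasoning

-- Pre-types and reduction in the coordinates (i, j, l).

Y₁₂ Y₈ Y₄ : PreType → ℚ⁺
Y₁₂ ⟨ l , ρ , b ⟩ = Δ l ρ b
Y₈  ⟨ l , ρ , b ⟩ = Δ b l ρ
Y₄  ⟨ l , ρ , b ⟩ = Δ ρ b l

ones : PreType
ones = ⟨ 1⁺ , 1⁺ , 1⁺ ⟩

⟨,,⟩-cong : ∀ {l l′ ρ ρ′ b b′} → l ≡ l′ → ρ ≡ ρ′ → b ≡ b′ → ⟨ l , ρ , b ⟩ ≡ ⟨ l′ , ρ′ , b′ ⟩
⟨,,⟩-cong refl refl refl = refl

-- By definition `Y₁₂`, `Y₈`, `Y₄` of `turn τ` are `Y₄`, `Y₁₂`, `Y₈` of `τ`, so the formula for the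
-- left label also serves the other two sides.
turn : PreType → PreType
turn ⟨ l , ρ , b ⟩ = ⟨ ρ , b , l ⟩

turn² : PreType → PreType
turn² τ = turn (turn τ)

SameType-turn : ∀ τ → SameType (turn τ) τ
SameType-turn ⟨ l , ρ , b ⟩ = shift l (ρ ∷ b ∷ []) []

-- One labeling holds grids of every size at once, the size being `i + j + l + 1`.
Labeling : Set
Labeling = ℕ → ℕ → ℕ → PreType

rotate : Labeling → Labeling
rotate P i j l = turn (P l i j)

series : (τ τ′ : PreType) → ℚ⁺
series τ τ′ = Y₈ τ +⁺ Y₁₂ τ′

star : (τ τ′ τ″ : PreType) → ℚ⁺
star τ τ′ τ″ = Y (Y₄ τ) (Y₈ τ′) (Y₁₂ τ″)

reducedLeft : Labeling → ℕ → ℕ → ℕ → ℚ⁺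
reducedLeft P zero    j l = series (P 0 j (suc l)) (P 0 (suc j) l)
reducedLeft P (suc i) j l = star (P i (suc j) (suc l)) (P (suc i) j (suc l)) (P (suc i) (suc j) l)

reduced : Labeling → Labeling
reduced P i j l =
  ⟨ reducedLeft P i j l
  , reducedLeft (rotate P) j l i
  , reducedLeft (rotate (rotate P)) l i j ⟩

labeling : ℕ → Labeling
labeling zero    = λ _ _ _ → ones
labeling (suc k) = reduced (labeling k)

-- `rotate (reduced P)` and `reduced (rotate P)` are equal by definition, because three rotations
-- give back `P` by eta. Hence an equality of functions is reached without extensionality.
labeling-rotate : ∀ k → rotate (labeling k) ≡ labeling k
labeling-rotate zero    = refl
labeling-rotate (suc k) = cong reduced (labeling-rotate k)

labeling-turn : ∀ k i j l → labeling k i j l ≡ turn (labeling k l i j)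
labeling-turn k i j l = sym (cong (λ P → P i j l) (labeling-rotate k))

labeling-turn² : ∀ k i j l → labeling k i j l ≡ turn² (labeling k j l i)
labeling-turn² k i j l =
  trans (labeling-turn k i j l) (cong turn (labeling-turn k l i j))

-- The neighbourhood of the left side.

-- The pre-type after k reductions of the triangles with j , l ≥ k.  In the recursive step
-- any positive values of j and l would do in place of 1.
uniform : ℕ → ℕ → PreType
uniform zero    i = ones
uniform (suc k) i = reduced (λ i′ _ _ → uniform k i′) i 1 1

-- The reflection that swaps right and base also swaps `Y₈` and `Y₁₂`. By induction these agree at
-- `suc i`, so the new right and base labels are `Y` of the same values up to the order of the last
-- two arguments.
uniform-right≡base : ∀ k i → right (uniform k i) ≡ base (uniform k i)
uniform-right≡base zero    i = refl
uniform-right≡base (suc k) i = begin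
  Y (Y₈ τ′) (Y₁₂ τ′) (Y₄ τ)    ≡⟨ cong₂ (λ x y → Y x y (Y₄ τ)) Y₈≡Y₁₂ (sym Y₈≡Y₁₂) ⟩
  Y (Y₁₂ τ′) (Y₈ τ′) (Y₄ τ)    ≡⟨ Y-comm (Y₁₂ τ′) (Y₈ τ′) (Y₄ τ) ⟩
  Y (Y₁₂ τ′) (Y₄ τ) (Y₈ τ′)    ∎
  where
  open ≡-Reasoning
  τ τ′ : PreType
  τ  = uniform k i
  τ′ = uniform k (suc i)
  Y₈≡Y₁₂ : Y₈ τ′ ≡ Y₁₂ τ′
  Y₈≡Y₁₂ = begin
    Δ (base τ′) (left τ′) (right τ′)  ≡⟨ Δ-comm (base τ′) (left τ′) (right τ′) ⟩
    Δ (left τ′) (base τ′) (right τ′)  ≡⟨ cong₂ (Δ (left τ′)) (sym e) e ⟩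
    Δ (left τ′) (right τ′) (base τ′)  ∎
    where e = uniform-right≡base k (suc i)

star-cong : ∀ {τ σ τ′ σ′ τ″ σ″} → τ ≡ σ → τ′ ≡ σ′ → τ″ ≡ σ″ → star τ τ′ τ″ ≡ star σ σ′ σ″
star-cong refl refl refl = refl

-- The series case `i = 0` is the only source of other labels, and its influence moves inward by one
-- diagonal per reduction. Elsewhere Δ(1,1,1) = 1/3 and Y(1/3,1/3,1/3) = 1, which Agda computes.
uniform≡ones : ∀ k i → k ≤ i → uniform k i ≡ ones
uniform≡ones zero    i       _         = refl
uniform≡ones (suc k) (suc i) (s≤s k≤i) = ⟨,,⟩-cong
  (star-cong here next next)
  (star-cong (cong turn next₂) (cong turn next₂) (cong turn next))
  (star-cong (cong turn² next₂) (cong turn² next) (cong turn² next₂))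
  where
  here  = uniform≡ones k i k≤i
  next  = uniform≡ones k (suc i) (m≤n⇒m≤1+n k≤i)
  next₂ = uniform≡ones k (suc (suc i)) (m≤n⇒m≤1+n (m≤n⇒m≤1+n k≤i))

mutual
  -- Positive `j` and `l` put the right and base labels in the star case, and one reduction looks at
  -- triangles whose `j` and `l` are smaller by at most one.
  labeling≡uniform : ∀ k i j l → k ≤ j → k ≤ l → labeling k i j l ≡ uniform k i
  labeling≡uniform zero    i j       l       _         _         = refl
  labeling≡uniform (suc k) i (suc j) (suc l) (s≤s k≤j) (s≤s k≤l) = ⟨,,⟩-cong
    (left-labeling≡uniform k i (suc j) (suc l) k≤1+j k≤1+l)
    (star-cong
      (cong turn (labeling≡uniform k (suc i) j (suc (suc l)) k≤j (m≤n⇒m≤1+n k≤1+l)))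
      (cong turn (labeling≡uniform k (suc i) (suc j) (suc l) k≤1+j k≤1+l))
      (cong turn (labeling≡uniform k i (suc j) (suc (suc l)) k≤1+j (m≤n⇒m≤1+n k≤1+l))))
    (star-cong
      (cong turn² (labeling≡uniform k (suc i) (suc (suc j)) l (m≤n⇒m≤1+n k≤1+j) k≤l))
      (cong turn² (labeling≡uniform k i (suc (suc j)) (suc l) (m≤n⇒m≤1+n k≤1+j) k≤1+l))
      (cong turn² (labeling≡uniform k (suc i) (suc j) (suc l) k≤1+j k≤1+l)))
    where
    k≤1+j = m≤n⇒m≤1+n k≤j
    k≤1+l = m≤n⇒m≤1+n k≤l

  -- The left label is computed from triangles with the same or larger `j` and `l`, so the bound `k`
  -- suffices for `suc k` reductions.
  left-labeling≡uniform : ∀ k i j l → k ≤ j → k ≤ l →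
    left (labeling (suc k) i j l) ≡ left (uniform (suc k) i)
  left-labeling≡uniform k zero    j l k≤j k≤l = cong₂ series
    (labeling≡uniform k 0 j (suc l) k≤j (m≤n⇒m≤1+n k≤l))
    (labeling≡uniform k 0 (suc j) l (m≤n⇒m≤1+n k≤j) k≤l)
  left-labeling≡uniform k (suc i) j l k≤j k≤l = star-cong
    (labeling≡uniform k i (suc j) (suc l) (m≤n⇒m≤1+n k≤j) (m≤n⇒m≤1+n k≤l))
    (labeling≡uniform k (suc i) j (suc l) k≤j (m≤n⇒m≤1+n k≤l))
    (labeling≡uniform k (suc i) (suc j) l (m≤n⇒m≤1+n k≤j) k≤l)

-- From rows and diagonals to (i, j, l).

record At (m : ℕ) (t : Triangle) (i j l : ℕ) : Set where
  constructor at
  field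
    triangle : t ≡ (suc (i + j) , suc i)
    size     : m ≡ suc (i + j + l)

≡⇒≡ᵇ-true : ∀ {m n} → m ≡ n → (m ≡ᵇ n) ≡ true
≡⇒≡ᵇ-true {zero}  refl = refl
≡⇒≡ᵇ-true {suc m} refl = ≡⇒≡ᵇ-true {m} refl

≡ᵇ-+-suc : ∀ m n → (m ≡ᵇ m + suc n) ≡ false
≡ᵇ-+-suc zero    n = refl
≡ᵇ-+-suc (suc m) n = ≡ᵇ-+-suc m n

module _ {A : Set} {x y : A} where

  if-true : ∀ {b} → b ≡ true → (if b then x else y) ≡ x
  if-true refl = refl

  if-false : ∀ {b} → b ≡ false → (if b then x else y) ≡ y
  if-false refl = refl

-- Induction on `k`, side by side: the boundary tests `d ≡ᵇ 1`, `d ≡ᵇ r` and `r ≡ᵇ M` become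
-- `i = 0`, `j = 0` and `l = 0`.
preType-reductions : ∀ k {m t i j l} → At m t i j l → preType (reductions k m) t ≡ labeling k i j l
preType-reductions zero    _ = refl
preType-reductions (suc k) {i = i₀} {j₀} {l₀} (at refl refl) =
  ⟨,,⟩-cong (newLeft i₀ j₀ l₀) (newRight i₀ j₀ l₀) (newBase i₀ j₀ l₀)
  where
  module New (i j l : ℕ) = Defs.Reduction (reductions k (suc (suc (i + j + l))))
  r : ℕ → ℕ → ℕ
  r i j = suc (i + j)
  P : Labeling
  P = labeling k

  old : ∀ i j l {m r d} → r ≡ suc (i + j) → d ≡ suc i → m ≡ suc (i + j + l) →
    preType (reductions k m) (r , d) ≡ P i j l
  old i j l refl refl e = preType-reductions k (at refl e)

  1+r : ∀ i j → suc (r i j) ≡ r i (suc j)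
  1+r i j = cong suc (sym (+-suc i j))
  size-j : ∀ i j l → suc (suc (i + j + l)) ≡ suc (i + suc j + l)
  size-j = solve-∀
  size-l : ∀ i j l → suc (suc (i + j + l)) ≡ suc (i + j + suc l)
  size-l = solve-∀
  size-i+1,j-1,l+1 : ∀ i j l → suc (suc (i + suc j + l)) ≡ suc (suc i + j + suc l)
  size-i+1,j-1,l+1 = solve-∀
  size-i-1,j+1,l+1 : ∀ i j l → suc (suc (suc i + j + l)) ≡ suc (i + suc j + suc l)
  size-i-1,j+1,l+1 = solve-∀
  size-i+1,j+1,l-1 : ∀ i j l → suc (suc (i + j + suc l)) ≡ suc (suc i + suc j + l)
  size-i+1,j+1,l-1 = solve-∀

  newLeft : ∀ i j l → New.newLeft i j l (r i j) (suc i) ≡ reducedLeft P i j l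
  newLeft zero    j l = cong₂ series
    (old 0 j (suc l) refl refl (size-l 0 j l))
    (old 0 (suc j) l refl refl refl)
  newLeft (suc i) j l = star-cong
    (old i (suc j) (suc l) (1+r i j) refl (size-i-1,j+1,l+1 i j l))
    (old (suc i) j (suc l) refl refl (size-l (suc i) j l))
    (old (suc i) (suc j) l (1+r (suc i) j) refl (size-j (suc i) j l))

  newRight : ∀ i j l → New.newRight i j l (r i j) (suc i) ≡ reducedLeft (rotate P) j l i
  newRight i zero l = begin
    New.newRight i 0 l (r i 0) (suc i)
      ≡⟨ if-true (≡⇒≡ᵇ-true (sym (+-identityʳ i))) ⟩
    New.Y₄ i 0 l (r i 0) (r i 0) +⁺ New.Y₁₂ i 0 l (suc (r i 0)) (suc (r i 0))
      ≡⟨ cong₂ (λ τ τ′ → Y₄ τ +⁺ Y₁₂ τ′)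
           (old i 0 (suc l) refl (cong suc (+-identityʳ i)) (size-l i 0 l))
           (old (suc i) 0 l refl (cong (λ x → suc (suc x)) (+-identityʳ i)) refl) ⟩
    Y₄ (P i 0 (suc l)) +⁺ Y₁₂ (P (suc i) 0 l)
      -- On the right side the two series terms come in the opposite order to the rotated left
      -- formula.
      ≡⟨ +⁺-comm (Y₄ (P i 0 (suc l))) (Y₁₂ (P (suc i) 0 l)) ⟩
    Y₁₂ (P (suc i) 0 l) +⁺ Y₄ (P i 0 (suc l))  ∎
    where open ≡-Reasoning
  newRight i (suc j) l = trans (if-false (≡ᵇ-+-suc i j)) (star-cong
    (cong turn (old (suc i) j (suc l) (cong suc (+-suc i j)) refl (size-i+1,j-1,l+1 i j l)))
    (cong turn (old (suc i) (suc j) l refl refl refl))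
    (cong turn (old i (suc j) (suc l) refl refl (size-l i (suc j) l))))

  newBase : ∀ i j l → New.newBase i j l (r i j) (suc i) ≡ reducedLeft (rotate (rotate P)) l i j
  newBase i j zero = trans (if-true (≡⇒≡ᵇ-true (sym (+-identityʳ (i + j)))))
    (cong₂ (λ τ τ′ → Y₄ τ +⁺ Y₈ τ′)
      (old i (suc j) 0 (cong suc e) refl (size-j i j 0))
      (old (suc i) j 0 (cong (λ x → suc (suc x)) (+-identityʳ (i + j))) refl refl))
    where
    e : suc (i + j + 0) ≡ i + suc j
    e = trans (cong suc (+-identityʳ (i + j))) (sym (+-suc i j))
  newBase i j (suc l) = trans (if-false (≡ᵇ-+-suc (i + j) l)) (star-cong
    (cong turn² (old (suc i) (suc j) l (1+r (suc i) j) refl (size-i+1,j+1,l-1 i j l)))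
    (cong turn² (old i (suc j) (suc l) (1+r i j) refl (size-j i j (suc l))))
    (cong turn² (old (suc i) j (suc l) refl refl refl)))

-- Coordinates of the uniform center and of the subgrid.

-- Here `x` and `y` are the slacks in the two bounds on `q`. Each of the three triangles is at
-- distance `i` from its own side and at least `s` from the other two.
uniform-positions : ∀ {s N i q} → s ≤ N → s + suc i ≤ q → q ≤ N ∸ s → ∃[ x ] ∃[ y ]
  At N (q , suc i) i (s + x) (s + y) ×
  At N (q , suc q ∸ suc i) (s + x) i (s + y) ×
  At N (suc (N ∸ suc i) , suc q ∸ suc i) (s + x) (s + y) i
uniform-positions {s} {N} {i} {q} s≤N s+d≤q q≤N∸s
  with m≤n⇒∃[o]m+o≡n s+d≤q | m≤n⇒∃[o]m+o≡n q≤N∸s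
... | x , s+d+x≡q | y , q+y≡N∸s =
  x , y , at (cong (_, suc i) q≡) N≡ , at (cong₂ _,_ q≡′ column) N≡′ ,
  at (cong₂ _,_ (cong suc row) column) N≡″
  where
  open ≡-Reasoning
  arrange : ∀ s i x → s + suc i + x ≡ suc (i + (s + x))
  arrange = solve-∀
  q≡ : q ≡ suc (i + (s + x))
  q≡ = trans (sym s+d+x≡q) (arrange s i x)
  q≡′ : q ≡ suc (s + x + i)
  q≡′ = trans q≡ (cong suc (+-comm i (s + x)))
  column : suc q ∸ suc i ≡ suc (s + x)
  column = trans (cong (_∸ i) (trans q≡ (sym (+-suc i (s + x))))) (m+n∸m≡n i (suc (s + x)))
  N≡q+s+y : N ≡ q + (s + y)
  N≡q+s+y = begin
    N            ≡⟨ m∸n+n≡m s≤N ⟨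
    N ∸ s + s    ≡⟨ cong (_+ s) q+y≡N∸s ⟨
    q + y + s    ≡⟨ assoc-comm q y s ⟩
    q + (s + y)  ∎
    where
    assoc-comm : ∀ a b c → a + b + c ≡ a + (c + b)
    assoc-comm = solve-∀
  N≡ : N ≡ suc (i + (s + x) + (s + y))
  N≡ = trans N≡q+s+y (cong (_+ (s + y)) q≡)
  N≡′ : N ≡ suc (s + x + i + (s + y))
  N≡′ = trans N≡q+s+y (cong (_+ (s + y)) q≡′)
  N≡d+ : N ≡ suc i + (s + x + (s + y))
  N≡d+ = trans N≡ (+-assoc (suc i) (s + x) (s + y))
  N≡″ : N ≡ suc (s + x + (s + y) + i)
  N≡″ = trans N≡d+ (cong suc (+-comm i (s + x + (s + y))))
  row : N ∸ suc i ≡ s + x + (s + y)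
  row = trans (cong (_∸ suc i) N≡d+) (m+n∸m≡n (suc i) (s + x + (s + y)))

-- Triangles of the `suc k`-subgrid are at distance at least `k` from every side of the grid. The
-- slacks `x`, `y`, `z` are their distances from the sides of the subgrid, and the last three
-- equations detect when one vanishes.
subgrid-position : ∀ {N k r d} → k ≤ N → (r , d) ∈ Subgrid.Triangles N (suc k) →
  ∃[ x ] ∃[ y ] ∃[ z ]
    At N (r , d) (k + x) (k + y) (k + z) ×
    suc k + x ≡ d × d + y ≡ suc (r ∸ suc k) × r + z ≡ N ∸ k
subgrid-position {N} {k} {r} k≤N ((2s∸1≤r , r≤N∸k) , s≤d , d≤)
  with m≤n⇒∃[o]m+o≡n s≤d | m≤n⇒∃[o]m+o≡n d≤ | m≤n⇒∃[o]m+o≡n r≤N∸k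
... | x , refl | y , d+y≡ | z , r+z≡ =
  x , y , z , at (cong (_, suc (k + x)) r≡) N≡ , refl , d+y≡ , r+z≡
  where
  open ≡-Reasoning
  arrange₁ : ∀ k x y → k + x + y + suc k ≡ suc (k + x + (k + y))
  arrange₁ = solve-∀
  arrange₂ : ∀ r z k → r + z + k ≡ r + (k + z)
  arrange₂ = solve-∀
  r≡ : r ≡ suc (k + x + (k + y))
  r≡ = begin
    r                      ≡⟨ m∸n+n≡m (≤-trans (m≤n+m (suc k) k) (≤-trans (≤-reflexive (2s∸1≡ k)) 2s∸1≤r)) ⟨
    r ∸ suc k + suc k      ≡⟨ cong (_+ suc k) (suc-injective d+y≡) ⟨
    k + x + y + suc k      ≡⟨ arrange₁ k x y ⟩
    suc (k + x + (k + y))  ∎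
    where
    2s∸1≡ : ∀ k → k + suc k ≡ k + suc (k + 0)
    2s∸1≡ = solve-∀
  N≡ : N ≡ suc (k + x + (k + y) + (k + z))
  N≡ = begin
    N            ≡⟨ m∸n+n≡m k≤N ⟨
    N ∸ k + k    ≡⟨ cong (_+ k) r+z≡ ⟨
    r + z + k    ≡⟨ arrange₂ r z k ⟩
    r + (k + z)  ≡⟨ cong (_+ (k + z)) r≡ ⟩
    suc (k + x + (k + y) + (k + z))  ∎

preType-T : ∀ {s n t i j l} → s ≤ n → At (n ∸ s) t i j l → preType (T n (n ∸ s)) t ≡ labeling s i j l
preType-T {s} {n} {t} s≤n p = trans
  (cong (λ k → preType (reductions k (n ∸ s)) t) (m∸[m∸n]≡n s≤n))
  (preType-reductions s p)

-- Pre-types in the uniform center.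

module _ (s n : ℕ) (s≤n : s ≤ n) (s≤n∸s : s ≤ n ∸ s) (i : ℕ) where
  open UniformCenter n s (suc i)

  private
    g = T n (n ∸ s)

    positions : ∀ {q} → q ∈ InRange → ∃[ x ] ∃[ y ]
      At (n ∸ s) (q , suc i) i (s + x) (s + y) ×
      At (n ∸ s) (q , suc q ∸ suc i) (s + x) i (s + y) ×
      At (n ∸ s) (suc (n ∸ s ∸ suc i) , suc q ∸ suc i) (s + x) (s + y) i
    positions {q} (s+d≤q , q≤n∸2s) = uniform-positions s≤n∸s s+d≤q
      (≤-trans q≤n∸2s (≤-reflexive (trans (cong (λ t → n ∸ (s + t)) (+-identityʳ s)) (sym (∸-+-assoc n s s)))))

  preType-U₁ : ∀ t → t ∈ U₁ → preType g t ≡ uniform s i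
  preType-U₁ _ (q , q∈ , refl) with x , y , p , _ , _ ← positions q∈ =
    trans (preType-T s≤n p) (labeling≡uniform s i (s + x) (s + y) (m≤m+n s x) (m≤m+n s y))

  -- Rotating the right side to the left exchanges `s + x` and `s + y` as compared with `U₁`, which
  -- `uniform` does not see.
  preType-U₂ : ∀ t → t ∈ U₂ → preType g t ≡ turn² (uniform s i)
  preType-U₂ _ (q , q∈ , refl) with x , y , _ , p , _ ← positions q∈ =
    trans (preType-T s≤n p) (trans (labeling-turn² s (s + x) i (s + y))
      (cong turn² (labeling≡uniform s i (s + y) (s + x) (m≤m+n s y) (m≤m+n s x))))

  preType-U₃ : ∀ t → t ∈ U₃ → preType g t ≡ turn (uniform s i)
  preType-U₃ _ (q , q∈ , refl) with x , y , _ , _ , p ← positions q∈ =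
    trans (preType-T s≤n p) (trans (labeling-turn s (s + x) (s + y) i)
      (cong turn (labeling≡uniform s i (s + x) (s + y) (m≤m+n s x) (m≤m+n s y))))

  SameType-U : ∀ t → t ∈ U → SameType (preType g t) (uniform s i)
  SameType-U t (inj₁ t∈) rewrite preType-U₁ t t∈ = ↭-refl
  SameType-U t (inj₂ (inj₁ t∈)) rewrite preType-U₂ t t∈ =
    ↭-trans (SameType-turn (turn (uniform s i))) (SameType-turn (uniform s i))
  SameType-U t (inj₂ (inj₂ t∈)) rewrite preType-U₃ t t∈ = SameType-turn (uniform s i)

-- Edge labels of the subgrid.

module _ (k n : ℕ) (s≤n : suc k ≤ n) (2s≤n∸s : 2 * suc k ≤ n ∸ suc k) where
  open Subgrid (n ∸ suc k) (suc k)

  private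
    N : ℕ
    N = n ∸ suc k

    k≤N : k ≤ N
    k≤N = ≤-trans (≤-trans (n≤1+n k) (m≤m+n (suc k) (suc k + 0))) 2s≤n∸s

    -- The common label of edges facing a side of the grid at distance `i` from it. Each label is
    -- rotated into a left label, since at a corner of the subgrid two coordinates may equal `k`,
    -- too small for `labeling≡uniform` at `suc k`.
    e : ℕ → ℚ⁺
    e i = left (uniform (suc k) i)

    module _ {t i j l} (p : At N t i j l) where

      left-label : k ≤ j → k ≤ l → label (T n N) (t , L) ≡ e i
      left-label k≤j k≤l = trans (cong left (preType-T s≤n p)) (left-labeling≡uniform k i j l k≤j k≤l)

      right-label : k ≤ i → k ≤ l → label (T n N) (t , R) ≡ e j
      right-label k≤i k≤l = trans
        (cong right (trans (preType-T s≤n p) (labeling-turn² (suc k) i j l)))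
        (left-labeling≡uniform k j l i k≤l k≤i)

      base-label : k ≤ i → k ≤ j → label (T n N) (t , B) ≡ e l
      base-label k≤i k≤j = trans
        (cong base (trans (preType-T s≤n p) (labeling-turn (suc k) i j l)))
        (left-labeling≡uniform k l i j k≤i k≤j)

    e≡1 : ∀ x → e (k + suc x) ≡ 1⁺
    e≡1 x = cong left (uniform≡ones (suc k) (k + suc x)
      (≤-trans (s≤s (m≤m+n k x)) (≤-reflexive (sym (+-suc k x)))))

    m+n≡m⇒n≡0 : ∀ m {n} → m + n ≡ m → n ≡ 0
    m+n≡m⇒n≡0 m {n} eq = +-cancelˡ-≡ m n 0 (trans eq (sym (+-identityʳ m)))

  -- The slack towards the side that the edge faces decides: if positive, `e≡1` applies; if zero,
  -- the edge lies on `∂²`.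
  interior-label : ∀ a → a ∈ Interior → label (T n N) a ≡ 1⁺
  interior-label ((r , d) , X) (t∈@(r∈ , s≤d , d≤) , ∉∂²)
    with x , y , z , p , d≡ , r≡ , N≡ ← subgrid-position k≤N t∈ = by-side X x y z p d≡ r≡ N≡ ∉∂²
    where
    by-side : ∀ X x y z → At N (r , d) (k + x) (k + y) (k + z) →
      suc k + x ≡ d → d + y ≡ suc (r ∸ suc k) → r + z ≡ N ∸ k →
      ¬ ((r , d) , X) ∈ ∂² → label (T n N) ((r , d) , X) ≡ 1⁺
    by-side L (suc x) y z p _ _ _ _ =
      trans (left-label p (m≤m+n k y) (m≤m+n k z)) (e≡1 x)
    by-side R x (suc y) z p _ _ _ _ =
      trans (right-label p (m≤m+n k x) (m≤m+n k z)) (e≡1 y)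
    by-side B x y (suc z) p _ _ _ _ =
      trans (base-label p (m≤m+n k x) (m≤m+n k y)) (e≡1 z)
    by-side L zero y z p d≡ _ _ ∉∂² = contradiction
      (inj₁ (r , r∈ , cong (λ d → (r , d) , L) (trans (sym d≡) (+-identityʳ (suc k))))) ∉∂²
    by-side R x zero z p _ r≡ _ ∉∂² = contradiction
      (inj₂ (inj₁ (r , r∈ , cong (λ d → (r , d) , R) (trans (sym (+-identityʳ d)) r≡)))) ∉∂²
    by-side B x y zero (at _ N≡′) d≡ r≡ N≡ ∉∂² = contradiction
      (inj₂ (inj₂ (d , (s≤d , d≤max) , cong (λ r → (r , d) , B) (trans (sym (+-identityʳ r)) N≡)))) ∉∂²
      where
      arrange : ∀ k x y → suc (suc (suc (k + x + (k + y) + (k + 0)))) ≡ suc k + x + 2 * suc k + y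
      arrange = solve-∀
      -- With `z = 0` the size equation reads N + 2 = d + 2 * suc k + y.
      d≤max : d ≤ suc (suc N) ∸ 2 * suc k
      d≤max = m+n≤o⇒m≤o∸n d (subst (λ d → d + 2 * suc k ≤ suc (suc N)) d≡
        (≤-trans (m≤m+n (suc k + x + 2 * suc k) y)
          (≤-reflexive (sym (trans (cong (λ N → suc (suc N)) N≡′) (arrange k x y))))))

  private
    s≤diagonal : ∀ {r} → r ∈ Row → suc k ≤ suc (r ∸ suc k)
    s≤diagonal {r} (2s∸1≤r , _) =
      s≤s (m+n≤o⇒m≤o∸n k (≤-trans (≤-reflexive (cong (λ t → k + suc t) (sym (+-identityʳ k)))) 2s∸1≤r))

    base∈Triangles : ∀ {d} → suc k ≤ d → d ≤ suc (suc N) ∸ 2 * suc k → (N ∸ k , d) ∈ Triangles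
    base∈Triangles {d} s≤d d≤ = (2s∸1≤ , ≤-refl) , s≤d , d≤ℓ
      where
      d+2s≤2+N : d + 2 * suc k ≤ suc (suc N)
      d+2s≤2+N = m≤o∸n⇒m+n≤o d (m≤n⇒m≤1+n (m≤n⇒m≤1+n 2s≤n∸s)) d≤
      2s∸1≤ : 2 * suc k ∸ 1 ≤ N ∸ k
      -- The bottom row is low enough because it has a diagonal `d`: with s = `suc k`, s ≤ d and d +
      -- 2s ≤ N + 2 give 3s ≤ N + 2.
      2s∸1≤ = m+n≤o⇒m≤o∸n (2 * suc k ∸ 1) (s≤s⁻¹ (≤-trans
        (≤-reflexive (arrange k)) (s≤s⁻¹ (≤-trans (+-monoˡ-≤ (2 * suc k) s≤d) d+2s≤2+N))))
        where
        arrange : ∀ k → suc (k + suc (k + 0) + k) ≡ k + 2 * suc k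
        arrange = solve-∀
      d≤ℓ : d ≤ suc (N ∸ k ∸ suc k)
      d≤ℓ = ≤-trans (m≤n+m∸n d 1) (s≤s (subst (d ∸ 1 ≤_) (sym (∸-+-assoc N k (suc k)))
        (m+n≤o⇒m≤o∸n (d ∸ 1) (s≤s⁻¹ (s≤s⁻¹ (≤-trans (≤-reflexive shifted) d+2s≤2+N))))))
        where
        arrange : ∀ d k → suc (suc (d + (k + suc k))) ≡ suc d + 2 * suc k
        arrange = solve-∀
        shifted : suc (suc (d ∸ 1 + (k + suc k))) ≡ d + 2 * suc k
        shifted = trans (arrange (d ∸ 1) k)
          (cong (_+ 2 * suc k) (m+[n∸m]≡n (≤-trans (s≤s z≤n) s≤d)))

  -- On each of the three parts of `∂²` the slack towards that side cancels to zero, which leaves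
  -- distance exactly `k`.
  boundary-label : ∀ a → a ∈ ∂² → label (T n N) a ≡ e k
  boundary-label _ (inj₁ (r , r∈ , refl))
    with x , y , z , p , d≡ , _ , _ ← subgrid-position k≤N (r∈ , ≤-refl , s≤diagonal r∈)
    with refl ← m+n≡m⇒n≡0 (suc k) d≡ =
    trans (left-label p (m≤m+n k y) (m≤m+n k z)) (cong e (+-identityʳ k))
  boundary-label _ (inj₂ (inj₁ (r , r∈ , refl)))
    with x , y , z , p , _ , r≡ , _ ← subgrid-position k≤N (r∈ , s≤diagonal r∈ , ≤-refl)
    with refl ← m+n≡m⇒n≡0 (suc (r ∸ suc k)) r≡ =
    trans (right-label p (m≤m+n k x) (m≤m+n k z)) (cong e (+-identityʳ k))
  boundary-label _ (inj₂ (inj₂ (d , (s≤d , d≤) , refl)))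
    with x , y , z , p , _ , _ , N≡ ← subgrid-position k≤N (base∈Triangles s≤d d≤)
    with refl ← m+n≡m⇒n≡0 (N ∸ k) N≡ =
    trans (base-label p (m≤m+n k x) (m≤m+n k y)) (cong e (+-identityʳ k))

-- Assembly of the four claims from the bound `4 * s ≤ n`.

theorem6p5 : (s n : ℕ) → 1 ≤ s → 4 * s ≤ n →
  let g = T n (n ∸ s)
      open UniformCenter n s
      open Subgrid (n ∸ s) s
  in
  ((d : ℕ) → 1 ≤ d → d ≤ s →
    SinglePreType g (U₁ d) × SinglePreType g (U₂ d) × SinglePreType g (U₃ d))
  ×
  ((d : ℕ) → 1 ≤ d → d ≤ s →
    ∀ t t′ → t ∈ U d → t′ ∈ U d → SameType (preType g t) (preType g t′))
  ×
  ((∀ e → e ∈ Interior → label g e ≡ 1⁺)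
    × (∀ e e′ → e ∈ ∂² → e′ ∈ ∂² → label g e ≡ label g e′))
  ×
  ((d : ℕ) → 1 ≤ d → d ≤ s →
    (∀ t → t ∈ U₁ d → right (preType g t) ≡ base (preType g t))
    × (∀ t → t ∈ U₂ d → left (preType g t) ≡ base (preType g t))
    × (∀ t → t ∈ U₃ d → left (preType g t) ≡ right (preType g t)))
theorem6p5 (suc k) n _ 4s≤n =
  (λ { (suc i) _ _ → (_ , preType-U₁ s n s≤n s≤n∸s i) , (_ , preType-U₂ s n s≤n s≤n∸s i) , (_ , preType-U₃ s n s≤n s≤n∸s i) }) ,
  (λ { (suc i) _ _ t t′ t∈ t′∈ →
    ↭-trans (SameType-U s n s≤n s≤n∸s i t t∈) (↭-sym (SameType-U s n s≤n s≤n∸s i t′ t′∈)) }) ,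
  (interior-label k n s≤n 2s≤n∸s ,
   λ a a′ a∈ a′∈ → trans (boundary-label k n s≤n 2s≤n∸s a a∈) (sym (boundary-label k n s≤n 2s≤n∸s a′ a′∈))) ,
  (λ { (suc i) _ _ → let r≡b = uniform-right≡base s i in
    (λ t t∈ → trans (cong right (preType-U₁ s n s≤n s≤n∸s i t t∈))
      (trans r≡b (sym (cong base (preType-U₁ s n s≤n s≤n∸s i t t∈))))) ,
    (λ t t∈ → trans (cong left (preType-U₂ s n s≤n s≤n∸s i t t∈))
      (trans (sym r≡b) (sym (cong base (preType-U₂ s n s≤n s≤n∸s i t t∈))))) ,
    (λ t t∈ → trans (cong left (preType-U₃ s n s≤n s≤n∸s i t t∈))
      (trans r≡b (sym (cong right (preType-U₃ s n s≤n s≤n∸s i t t∈))))) })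
  where
  s : ℕ
  s = suc k
  s≤n : s ≤ n
  s≤n = ≤-trans (m≤m+n s (3 * s)) 4s≤n
  2s≤n∸s : 2 * s ≤ n ∸ s
  2s≤n∸s = m+n≤o⇒m≤o∸n (2 * s) (≤-trans (m≤m+n (2 * s + s) s) (≤-trans (≤-reflexive (3s+s s)) 4s≤n))
    where
    3s+s : ∀ s → 2 * s + s + s ≡ 4 * s
    3s+s = solve-∀
  s≤n∸s : s ≤ n ∸ s
  s≤n∸s = ≤-trans (m≤m+n s (s + 0)) 2s≤n∸s
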